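{- Let $q$ be a prime power, let $t$ be an integer with $2 \le t < q$, and let $d \ge 0$ be an integer with $q - d \ge t-1$. Put $r = \lfloor (q-d)/(t-1) \rfloor$. Then there exists an $(r;d)$-cover-free family with $q^2 + q$ points and $q^t$ blocks.
   Context: For integers $r \ge 1$, $d \ge 0$, a set system $(X,\mathcal{F})$ (a finite point set $X$ and a set $\mathcal{F}$ of subsets of $X$ called blocks) is an $(r;d)$-cover-free family if for every block $B_0 \in \mathcal{F}$ and every $r$ blocks $A_1,\dots,A_r \in \mathcal{F}$ different from $B_0$, one has $\left|B_0 \setminus \bigcup_{j=1}^r A_j\right| > d$. -}

module Defs where

open import Data.Nat using (ℕ; zero; suc; _^_; _≤_; _<_; s≤s; NonZero)
open import Data.Nat.Primality using (Prime)
open import Data.Product using (Σ; _×_)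
open import Data.Fin using (Fin)
open import Data.Fin.Subset using (Subset; _─_; ⋃; ∣_∣)
open import Data.List using (tabulate)
open import Relation.Binary.PropositionalEquality using (_≡_; _≢_)

IsPrimePower : ℕ → Set
IsPrimePower q = Σ ℕ λ p → Σ ℕ λ k → Prime p × 1 ≤ k × q ≡ p ^ k

-- A set system on the point set Fin n with m blocks, given as a family
-- B : Fin m → Subset n. It is a *set* of m blocks when B is injective.
-- (r;d)-cover-free: for every block B i and every r blocks
-- B (js 0), …, B (js (r-1)) different from B i,
-- | B i \ ⋃_k B (js k) | > d.
IsCoverFree : (r d : ℕ) {n m : ℕ} → (Fin m → Subset n) → Set
IsCoverFree r d {n} {m} B =
  (i : Fin m) (js : Fin r → Fin m) →
  (∀ k → B (js k) ≢ B i) →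
  d < ∣ B i ─ ⋃ (tabulate (λ k → B (js k))) ∣

nonZero-pred : ∀ {t} → 2 ≤ t → NonZero (Data.Nat._∸_ t 1)
nonZero-pred {suc (suc k)} (s≤s (s≤s _)) = _

{-# OPTIONS --safe #-}

-- The blocks are the graphs of the extended Reed–Solomon codewords: a polynomial f over 𝔽_q with t
-- coefficients gives the points (x , f x) for x ∈ 𝔽_q and (∞ , leading coefficient of f).  A block
-- has q + 1 points and two distinct blocks share at most t − 1, so r of them cover at most
-- r (t − 1) ≤ q − d points of another one.
--
-- The field with q = p^k elements is obtained as a quotient of 𝔽_p[X]/(X^(q−1) − 1), in which every
-- element satisfies a^q = a because Frobenius is additive.  The product u of X^(p^d) − X for
-- 1 ≤ d < k is non-zero there since its degree is less than q − 1.  Multiply u by ring elements as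
-- long as the product stays non-zero; the result e satisfies ea = 0 or a ∣ e for every a, so the
-- quotient K by the annihilator of e is a domain, and X^(p^d) ≠ X in K for 1 ≤ d < k.  Hence X has
-- k distinct conjugates, so 1, X, …, X^(k−1) are independent over 𝔽_p and K has at least p^k
-- elements; it has at most q since all of them are roots of T^q − T.
module Submission where

open import Defs
open import Algebra.Bundles using (CommutativeRing; Semiring)
open import Data.Empty using (⊥-elim)
open import Data.Fin as Fin using (Fin; zero; suc; toℕ; fromℕ; fromℕ<; inject₁; inject≤; punchIn; combine; remQuot; finToFun; funToFin)
import Data.Fin.Properties as Fin
open import Data.List as List using (List; []; _∷_; cartesianProductWith; upTo)
import Data.List.Membership.Propositional as List
open import Data.List.Membership.Propositional.Properties using (∈-cartesianProductWith⁺; ∈-upTo⁺)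
open import Data.List.Relation.Unary.All as All using (All; []; _∷_)
open import Data.List.Relation.Unary.Any using (here)
open import Data.Nat as ℕ using (ℕ; zero; suc)
open import Data.Nat.Combinatorics using (_C_; nCn≡1; nC1≡n; nCk+nC[k+1]≡[n+1]C[k+1]; k>n⇒nCk≡0)
open import Data.Nat.Coprimality using (prime⇒coprime; coprime-Bézout)
import Data.Nat.Divisibility as ℕ
open import Data.Nat.GCD using (module Bézout)
open import Data.Nat.Primality using (Prime; euclidsLemma; prime⇒nonTrivial; ¬prime[0])
import Data.Nat.Properties as ℕ
open import Data.Nat.Tactic.RingSolver using (solve-∀)
open import Data.Product using (Σ; ∃-syntax; _×_; _,_; proj₁; proj₂)
open import Data.Sum as Sum using (_⊎_; inj₁; inj₂)
open import Function using (_∘_)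
open import Function.Definitions using (Injective)
open import Level using (Level; 0ℓ)
open import Relation.Binary.Definitions using (Decidable; tri<; tri≈; tri>)
open import Relation.Binary.PropositionalEquality as ≡ using (_≡_)
open import Relation.Nullary using (¬_; yes; no; does)
open import Relation.Nullary.Decidable using (map′; dec-true)

-- Frobenius and polynomials over commutative rings

-- The absorption identity, from Pascal's rule by induction on both arguments; it exposes the factor
-- `suc n` from which divisibility by a prime is read off.
[1+k]*[1+n]C[1+k]≡[1+n]*nCk : ∀ n k → suc k ℕ.* (suc n C suc k) ≡ suc n ℕ.* (n C k)
[1+k]*[1+n]C[1+k]≡[1+n]*nCk n zero = begin
  1 ℕ.* (suc n C 1)  ≡⟨ ℕ.*-identityˡ _ ⟩
  suc n C 1          ≡⟨ nC1≡n (suc n) ⟩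
  suc n              ≡⟨ ℕ.*-identityʳ (suc n) ⟨
  suc n ℕ.* 1        ∎
  where open ≡.≡-Reasoning
[1+k]*[1+n]C[1+k]≡[1+n]*nCk zero (suc k) = begin
  suc (suc k) ℕ.* (1 C suc (suc k))  ≡⟨ ≡.cong (suc (suc k) ℕ.*_) (k>n⇒nCk≡0 {1} {suc (suc k)} (ℕ.s≤s (ℕ.s≤s ℕ.z≤n))) ⟩
  suc (suc k) ℕ.* 0                  ≡⟨ ℕ.*-zeroʳ (suc (suc k)) ⟩
  0                                  ≡⟨ ≡.cong (1 ℕ.*_) (k>n⇒nCk≡0 {0} {suc k} (ℕ.s≤s ℕ.z≤n)) ⟨
  1 ℕ.* (0 C suc k)                  ∎
  where open ≡.≡-Reasoning
[1+k]*[1+n]C[1+k]≡[1+n]*nCk (suc m) (suc j) = begin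
  suc k ℕ.* (suc n C suc k)                                  ≡⟨ ≡.cong (suc k ℕ.*_) (nCk+nC[k+1]≡[n+1]C[k+1] n k) ⟨
  -- One copy of `n C k` is set aside so that the other two summands have the shape of the induction
  -- hypotheses.
  suc k ℕ.* (n C k ℕ.+ n C suc k)                            ≡⟨ expand k (n C k) (n C suc k) ⟩
  n C k ℕ.+ (k ℕ.* (n C k) ℕ.+ suc k ℕ.* (n C suc k))
    ≡⟨ ≡.cong (n C k ℕ.+_) (≡.cong₂ ℕ._+_ ([1+k]*[1+n]C[1+k]≡[1+n]*nCk m j) ([1+k]*[1+n]C[1+k]≡[1+n]*nCk m k)) ⟩
  n C k ℕ.+ (n ℕ.* (m C j) ℕ.+ n ℕ.* (m C k))                ≡⟨ ≡.cong (n C k ℕ.+_) (ℕ.*-distribˡ-+ n (m C j) (m C k)) ⟨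
  n C k ℕ.+ n ℕ.* (m C j ℕ.+ m C k)                          ≡⟨ ≡.cong (λ z → n C k ℕ.+ n ℕ.* z) (nCk+nC[k+1]≡[n+1]C[k+1] m j) ⟩
  suc n ℕ.* (n C k)                                          ∎
  where
  open ≡.≡-Reasoning
  n = suc m
  k = suc j
  expand : ∀ k a b → suc k ℕ.* (a ℕ.+ b) ≡ a ℕ.+ (k ℕ.* a ℕ.+ suc k ℕ.* b)
  expand = solve-∀

-- By absorption `p` divides `suc k` times the binomial coefficient, and `suc k` is too small to be
-- a multiple of `p`.
prime∣pCk : ∀ {p} → Prime p → ∀ k → suc k ℕ.< p → p ℕ.∣ p C suc k
prime∣pCk {suc n} pr k k<p
  with euclidsLemma (suc k) (suc n C suc k) pr
         (≡.subst (suc n ℕ.∣_) (≡.sym ([1+k]*[1+n]C[1+k]≡[1+n]*nCk n k)) (ℕ.m∣m*n (n C k)))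
... | inj₁ p∣1+k = ⊥-elim (ℕ.<⇒≱ k<p (ℕ.∣⇒≤ p∣1+k))
... | inj₂ p∣C   = p∣C

module Characteristic {c ℓ : Level} (R : CommutativeRing c ℓ) where
  open CommutativeRing R hiding (zero)
  open import Algebra.Properties.CommutativeSemiring.Exp commutativeSemiring
  open import Algebra.Properties.Semiring.Mult semiring renaming (_×_ to _·_)
  open import Algebra.Properties.Semiring.Sum semiring
  import Algebra.Properties.CommutativeSemiring.Binomial commutativeSemiring as Binomial
  open import Relation.Binary.Reasoning.Setoid setoid

  ∣⇒·≈0 : ∀ {p n} → p · 1# ≈ 0# → p ℕ.∣ n → ∀ x → n · x ≈ 0#
  ∣⇒·≈0 {p} {n} p·1≈0 (ℕ.divides k ≡.refl) x = begin
    (k ℕ.* p) · x         ≈⟨ ×-assocˡ x k p ⟨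
    k · (p · x)           ≈⟨ ×-congʳ k (×-congʳ p (*-identityˡ x)) ⟨
    k · (p · (1# * x))    ≈⟨ ×-congʳ k (×-assoc-* p 1# x) ⟨
    k · ((p · 1#) * x)    ≈⟨ ×-congʳ k (*-congʳ p·1≈0) ⟩
    k · (0# * x)          ≈⟨ ×-comm-* k 0# x ⟨
    0# * (k · x)          ≈⟨ zeroˡ _ ⟩
    0#                    ∎

  1^n≈1 : ∀ n → 1# ^ n ≈ 1#
  1^n≈1 zero    = refl
  1^n≈1 (suc n) = trans (*-identityˡ _) (1^n≈1 n)

  module _ {p : ℕ} (pr : Prime p) (p·1≈0 : p · 1# ≈ 0#) where

    -- All inner coefficients of the binomial expansion are divisible by `p`, so only the first and
    -- the last term survive.
    frobenius-+ : ∀ x y → (x + y) ^ p ≈ x ^ p + y ^ p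
    frobenius-+ x y = go p ≡.refl
      where
      go : ∀ n → n ≡ p → (x + y) ^ n ≈ x ^ n + y ^ n
      go zero    ≡.refl = ⊥-elim (¬prime[0] pr)
      go (suc m) ≡.refl = begin
        (x + y) ^ p                                       ≈⟨ Binomial.theorem p x y ⟩
        term zero + sum (term ∘ suc)                      ≈⟨ +-congˡ (sum-init-last (term ∘ suc)) ⟩
        term zero + (sum (term ∘ suc ∘ inject₁) + term (suc (fromℕ m)))
          ≈⟨ +-cong first (+-cong (trans (sum-cong-≋ middle) (sum-replicate-zero m)) last) ⟩
        y ^ p + (0# + x ^ p)                              ≈⟨ +-congˡ (+-identityˡ _) ⟩
        y ^ p + x ^ p                                     ≈⟨ +-comm _ _ ⟩
        x ^ p + y ^ p                                     ∎
        where
        term : Fin (suc p) → Carrier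
        term = Binomial.binomialTerm x y p
        first : term zero ≈ y ^ p
        first = trans (×-homo-1 _) (*-identityˡ _)
        middle : ∀ i → term (suc (inject₁ i)) ≈ 0#
        middle i = ∣⇒·≈0 p·1≈0
          (prime∣pCk pr (toℕ (inject₁ i)) (ℕ.s≤s (≡.subst (ℕ._< m) (≡.sym (Fin.toℕ-inject₁ i)) (Fin.toℕ<n i)))) _
        last : term (suc (fromℕ m)) ≈ x ^ p
        last rewrite Fin.toℕ-fromℕ m | nCn≡1 (suc m) | ℕ.n∸n≡0 m = trans (×-homo-1 _) (*-identityʳ _)

    frobenius^-+ : ∀ n x y → (x + y) ^ (p ℕ.^ n) ≈ x ^ (p ℕ.^ n) + y ^ (p ℕ.^ n)
    frobenius^-+ zero    x y = trans (*-identityʳ _) (sym (+-cong (*-identityʳ _) (*-identityʳ _)))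
    frobenius^-+ (suc n) x y = begin
      (x + y) ^ (p ℕ.* p ℕ.^ n)                    ≈⟨ ^-assocʳ (x + y) p (p ℕ.^ n) ⟨
      ((x + y) ^ p) ^ (p ℕ.^ n)                    ≈⟨ ^-congˡ (p ℕ.^ n) (frobenius-+ x y) ⟩
      (x ^ p + y ^ p) ^ (p ℕ.^ n)                  ≈⟨ frobenius^-+ n (x ^ p) (y ^ p) ⟩
      (x ^ p) ^ (p ℕ.^ n) + (y ^ p) ^ (p ℕ.^ n)    ≈⟨ +-cong (^-assocʳ x p (p ℕ.^ n)) (^-assocʳ y p (p ℕ.^ n)) ⟩
      x ^ (p ℕ.* p ℕ.^ n) + y ^ (p ℕ.* p ℕ.^ n)    ∎

    -- Additivity at `0# + 0#` and cancellation, with no case distinction on the exponent.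
    0^p^n≈0 : ∀ n → 0# ^ (p ℕ.^ n) ≈ 0#
    0^p^n≈0 n = +-cancelʳ _ _ _ (trans (sym (frobenius^-+ n 0# 0#)) (trans (^-congˡ (p ℕ.^ n) (+-identityˡ 0#)) (sym (+-identityˡ _))))
      where open import Algebra.Properties.Group +-group using () renaming (∙-cancelʳ to +-cancelʳ)

    frobenius^-· : ∀ n m → (m · 1#) ^ (p ℕ.^ n) ≈ m · 1#
    frobenius^-· n zero    = 0^p^n≈0 n
    frobenius^-· n (suc m) = trans (frobenius^-+ n 1# (m · 1#)) (+-cong (1^n≈1 (p ℕ.^ n)) (frobenius^-· n m))

-- Polynomial evaluation and root counting

module Polynomial {c ℓ : Level} (R : CommutativeRing c ℓ) where
  open CommutativeRing R hiding (zero)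
  open import Algebra.Properties.Ring ring using (-‿distribʳ-*; -‿+-comm)
  open import Algebra.Properties.Group +-group using (//-rightDividesˡ; x∙y⁻¹≈ε⇒x≈y; x≈y⇒x∙y⁻¹≈ε)
  open import Algebra.Properties.CommutativeSemigroup +-commutativeSemigroup using (interchange)
  open import Relation.Binary.Reasoning.Setoid setoid

  eval : ∀ {n} → (Fin n → Carrier) → Carrier → Carrier
  eval {zero}  a x = 0#
  eval {suc n} a x = a zero + x * eval (a ∘ suc) x

  eval-cong : ∀ {n} (a : Fin n → Carrier) {x y} → x ≈ y → eval a x ≈ eval a y
  eval-cong {zero}  a x≈y = refl
  eval-cong {suc n} a x≈y = +-congˡ (*-cong x≈y (eval-cong (a ∘ suc) x≈y))

  eval-0 : ∀ {n} (a : Fin n → Carrier) x → (∀ i → a i ≈ 0#) → eval a x ≈ 0#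
  eval-0 {zero}  a x a≈0 = refl
  eval-0 {suc n} a x a≈0 = trans (+-cong (a≈0 zero) (trans (*-congˡ (eval-0 (a ∘ suc) x (a≈0 ∘ suc))) (zeroʳ x))) (+-identityˡ 0#)

  eval-- : ∀ {n} (a b : Fin n → Carrier) x → eval (λ i → a i - b i) x ≈ eval a x - eval b x
  eval-- {zero}  a b x = sym (-‿inverseʳ 0#)
  eval-- {suc n} a b x = begin
    (a zero - b zero) + x * eval (λ i → a (suc i) - b (suc i)) x  ≈⟨ +-congˡ (*-congˡ (eval-- (a ∘ suc) (b ∘ suc) x)) ⟩
    (a zero - b zero) + x * (A - B)                    ≈⟨ +-congˡ (distribˡ x A (- B)) ⟩
    (a zero - b zero) + (x * A + x * - B)              ≈⟨ +-congˡ (+-congˡ (-‿distribʳ-* x B)) ⟨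
    (a zero - b zero) + (x * A - x * B)                ≈⟨ interchange _ _ _ _ ⟩
    (a zero + x * A) + (- b zero - x * B)              ≈⟨ +-congˡ (-‿+-comm (b zero) (x * B)) ⟩
    (a zero + x * A) - (b zero + x * B)                ∎
    where
    A = eval (a ∘ suc) x
    B = eval (b ∘ suc) x

  -- The coefficients of the quotient of `a` by T - x, as in synthetic division.
  quot : ∀ {n} → Carrier → (Fin (suc n) → Carrier) → Fin n → Carrier
  quot x a zero    = eval (a ∘ suc) x
  quot x a (suc i) = quot x (a ∘ suc) i

  -- The second point is written `x + h`, which keeps subtraction out and makes the rearrangement a
  -- semiring identity.
  eval-quot : ∀ {n} (a : Fin (suc n) → Carrier) x h → eval a (x + h) ≈ eval a x + h * eval (quot x a) (x + h)
  eval-quot {zero} a x h = begin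
    a zero + (x + h) * 0#       ≈⟨ +-congˡ (distribʳ 0# x h) ⟩
    a zero + (x * 0# + h * 0#)  ≈⟨ +-assoc _ _ _ ⟨
    a zero + x * 0# + h * 0#    ∎
  eval-quot {suc n} a x h = begin
    a zero + (x + h) * eval (a ∘ suc) (x + h)      ≈⟨ +-congˡ (*-congˡ (eval-quot (a ∘ suc) x h)) ⟩
    a zero + (x + h) * (F + h * G)                 ≈⟨ rearrange (a zero) x h F G ⟩
    (a zero + x * F) + h * (F + (x + h) * G)       ∎
    where
    F = eval (a ∘ suc) x
    G = eval (quot x (a ∘ suc)) (x + h)
    rearrange : ∀ c x h F G → c + (x + h) * (F + h * G) ≈ (c + x * F) + h * (F + (x + h) * G)
    rearrange = solve 5 (λ c x h F G → c :+ (x :+ h) :* (F :+ h :* G) := (c :+ x :* F) :+ h :* (F :+ (x :+ h) :* G)) refl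
      where open import Algebra.Solver.Ring.NaturalCoefficients.Default commutativeSemiring

  -- Each quotient coefficient is a coefficient of `a` plus `x` times the next quotient coefficient;
  -- this unitriangular system is solved from the top down.
  quot≈0⇒tail≈0 : ∀ {n} (a : Fin (suc n) → Carrier) x → (∀ i → quot x a i ≈ 0#) → ∀ i → a (suc i) ≈ 0#
  quot≈0⇒tail≈0 {suc n} a x q≈0 (suc i) = quot≈0⇒tail≈0 (a ∘ suc) x (q≈0 ∘ suc) i
  quot≈0⇒tail≈0 {suc n} a x q≈0 zero    = begin
    a (suc zero)                                        ≈⟨ +-identityʳ _ ⟨
    a (suc zero) + 0#                                   ≈⟨ +-congˡ (zeroʳ x) ⟨
    a (suc zero) + x * 0#                               ≈⟨ +-congˡ (*-congˡ (eval-0 (λ i → a (suc (suc i))) x (quot≈0⇒tail≈0 (a ∘ suc) x (q≈0 ∘ suc)))) ⟨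
    a (suc zero) + x * eval (λ i → a (suc (suc i))) x           ≈⟨ q≈0 zero ⟩
    0#                                                  ∎

  module _ (domain : ∀ x y → x * y ≈ 0# → x ≈ 0# ⊎ y ≈ 0#) where

    -- Dividing by T - x₀ removes one coefficient and one root: in a domain the other points are
    -- roots of the quotient. Once the quotient vanishes, only the constant coefficient is left, and
    -- it is the value at `x₀`.
    vanishing : ∀ {n} (a xs : Fin n → Carrier) → Injective _≡_ _≈_ xs →
                (∀ i → eval a (xs i) ≈ 0#) → ∀ i → a i ≈ 0#
    vanishing {suc n} a xs inj a≈0 = λ where
        zero    → trans (sym (+-identityʳ _)) (trans (+-congˡ (sym tail-0)) (a≈0 zero))
        (suc i) → tail≈0 i
      where
      x₀ = xs zero
      q≈0 : ∀ j → eval (quot x₀ a) (xs (suc j)) ≈ 0#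
      q≈0 j with domain (xs (suc j) - x₀) (eval (quot x₀ a) (xs (suc j))) prod
        where
        x≈ : x₀ + (xs (suc j) - x₀) ≈ xs (suc j)
        x≈ = trans (+-comm _ _) (//-rightDividesˡ x₀ (xs (suc j)))
        prod : (xs (suc j) - x₀) * eval (quot x₀ a) (xs (suc j)) ≈ 0#
        prod = begin
          (xs (suc j) - x₀) * eval (quot x₀ a) (xs (suc j))               ≈⟨ *-congˡ (eval-cong (quot x₀ a) x≈) ⟨
          (xs (suc j) - x₀) * eval (quot x₀ a) (x₀ + (xs (suc j) - x₀))   ≈⟨ +-identityˡ _ ⟨
          0# + (xs (suc j) - x₀) * eval (quot x₀ a) (x₀ + (xs (suc j) - x₀)) ≈⟨ +-congʳ (a≈0 zero) ⟨
          eval a x₀ + (xs (suc j) - x₀) * eval (quot x₀ a) (x₀ + (xs (suc j) - x₀)) ≈⟨ eval-quot a x₀ _ ⟨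
          eval a (x₀ + (xs (suc j) - x₀))                                 ≈⟨ eval-cong a x≈ ⟩
          eval a (xs (suc j))                                             ≈⟨ a≈0 (suc j) ⟩
          0#                                                              ∎
      ... | inj₂ e = e
      ... | inj₁ e with () ← inj (x∙y⁻¹≈ε⇒x≈y _ _ e)
      tail≈0 : ∀ i → a (suc i) ≈ 0#
      tail≈0 = quot≈0⇒tail≈0 a x₀ (vanishing (quot x₀ a) (xs ∘ suc) (Fin.suc-injective ∘ inj) q≈0)
      tail-0 : x₀ * eval (a ∘ suc) x₀ ≈ 0#
      tail-0 = trans (*-congˡ (eval-0 (a ∘ suc) x₀ tail≈0)) (zeroʳ x₀)

    eval-determines : ∀ {n} (a b xs : Fin n → Carrier) → Injective _≡_ _≈_ xs →
                      (∀ i → eval a (xs i) ≈ eval b (xs i)) → ∀ i → a i ≈ b i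
    eval-determines a b xs inj eq i = x∙y⁻¹≈ε⇒x≈y _ _
      (vanishing (λ j → a j - b j) xs inj (λ j → trans (eval-- a b (xs j)) (x≈y⇒x∙y⁻¹≈ε (eq j))) i)

-- Quotients by annihilators

module Annihilator {c ℓ : Level} (R : CommutativeRing c ℓ) where
  open CommutativeRing R hiding (zero)
  open import Algebra.Properties.CommutativeSemiring.Exp commutativeSemiring
  open import Algebra.Properties.CommutativeSemigroup *-commutativeSemigroup using (x∙yz≈y∙xz; xy∙z≈xz∙y; xy∙z≈y∙xz)
  open import Relation.Binary.Reasoning.Setoid setoid

  -- Carrier and operations stay the same; two elements are identified when `e` annihilates their
  -- difference. Decidable equality thus carries over from `R`.
  modAnnihilator : Carrier → CommutativeRing c ℓ
  modAnnihilator e = record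
    { Carrier = Carrier
    ; _≈_ = λ x y → e * x ≈ e * y
    ; _+_ = _+_ ; _*_ = _*_ ; -_ = -_ ; 0# = 0# ; 1# = 1#
    ; isCommutativeRing = record
      { isRing = record
        { +-isAbelianGroup = record
          { isGroup = record
            { isMonoid = record
              { isSemigroup = record
                { isMagma = record
                  { isEquivalence = record { refl = refl ; sym = sym ; trans = trans }
                  ; ∙-cong = λ {x} {y} {z} {w} x≈y z≈w →
                      trans (distribˡ e x z) (trans (+-cong x≈y z≈w) (sym (distribˡ e y w)))
                  }
                ; assoc = λ x y z → *-congˡ (+-assoc x y z)
                }
              ; identity = (λ x → *-congˡ (+-identityˡ x)) , (λ x → *-congˡ (+-identityʳ x))
              }
            ; inverse = (λ x → *-congˡ (-‿inverseˡ x)) , (λ x → *-congˡ (-‿inverseʳ x))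
            ; ⁻¹-cong = λ {x} {y} x≈y →
                trans (sym (-‿distribʳ-* e x)) (trans (-‿cong x≈y) (-‿distribʳ-* e y))
            }
          ; comm = λ x y → *-congˡ (+-comm x y)
          }
        ; *-cong = λ {x} {y} {z} {w} x≈y z≈w → begin
            e * (x * z)  ≈⟨ *-assoc e x z ⟨
            (e * x) * z  ≈⟨ *-congʳ x≈y ⟩
            (e * y) * z  ≈⟨ xy∙z≈y∙xz e y z ⟩
            y * (e * z)  ≈⟨ *-congˡ z≈w ⟩
            y * (e * w)  ≈⟨ x∙yz≈y∙xz y e w ⟩
            e * (y * w)  ∎
        ; *-assoc = λ x y z → *-congˡ (*-assoc x y z)
        ; *-identity = (λ x → *-congˡ (*-identityˡ x)) , (λ x → *-congˡ (*-identityʳ x))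
        ; distrib = (λ x y z → *-congˡ (distribˡ x y z)) , (λ x y z → *-congˡ (distribʳ x y z))
        }
      ; *-comm = λ x y → *-congˡ (*-comm x y)
      }
    }
    where open import Algebra.Properties.Ring ring using (-‿distribʳ-*)

  _∣_ : Carrier → Carrier → Set _
  x ∣ y = ∃[ z ] x * z ≈ y

  -- Each `a` is multiplied in exactly when the product stays non-zero. Both outcomes persist,
  -- because the current `u` divides the final `e`.
  saturate : Decidable _≈_ → (as : List Carrier) → ∀ u → ¬ u ≈ 0# →
             ∃[ e ] ¬ e ≈ 0# × u ∣ e × All (λ a → e * a ≈ 0# ⊎ a ∣ e) as
  saturate _≟_ []       u u≉0 = u , u≉0 , (1# , *-identityʳ u) , []
  saturate _≟_ (a ∷ as) u u≉0 with (u * a) ≟ 0#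
  ... | yes ua≈0 with e , e≉0 , (z , uz≈e) , all ← saturate _≟_ as u u≉0 =
    e , e≉0 , (z , uz≈e) , inj₁ ea≈0 ∷ all
    where
    ea≈0 : e * a ≈ 0#
    ea≈0 = begin
      e * a        ≈⟨ *-congʳ uz≈e ⟨
      (u * z) * a  ≈⟨ xy∙z≈xz∙y u z a ⟩
      (u * a) * z  ≈⟨ *-congʳ ua≈0 ⟩
      0# * z       ≈⟨ zeroˡ z ⟩
      0#           ∎
  ... | no ua≉0 with e , e≉0 , (z , uaz≈e) , all ← saturate _≟_ as (u * a) ua≉0 =
    e , e≉0 , (a * z , trans (sym (*-assoc u a z)) uaz≈e)
      , inj₂ (u * z , trans (sym (xy∙z≈y∙xz u a z)) uaz≈e) ∷ all

  module _ (m : ℕ) (x^≈x : ∀ x → x ^ suc (suc m) ≈ x) where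

    -- The power `a ^ suc m` acts as the identity on multiples of `a`.
    ∣⇒*^≈ : ∀ {a e} → a ∣ e → e * a ^ suc m ≈ e
    ∣⇒*^≈ {a} {e} (z , az≈e) = begin
      e * a ^ suc m        ≈⟨ *-congʳ az≈e ⟨
      (a * z) * a ^ suc m  ≈⟨ xy∙z≈xz∙y a z _ ⟩
      a ^ suc (suc m) * z  ≈⟨ *-congʳ (x^≈x a) ⟩
      a * z                ≈⟨ az≈e ⟩
      e                    ∎

    -- On multiples of `e`, the power `a ^ m` is an inverse of `a`.
    ∣⇒cancel : ∀ {a e} → a ∣ e → ∀ b → e * (a * b) ≈ 0# → e * b ≈ 0#
    ∣⇒cancel {a} {e} a∣e b eab≈0 = begin
      e * b                      ≈⟨ *-congʳ (∣⇒*^≈ a∣e) ⟨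
      (e * (a * a ^ m)) * b      ≈⟨ rearrange e a (a ^ m) b ⟩
      (e * (a * b)) * a ^ m      ≈⟨ *-congʳ eab≈0 ⟩
      0# * a ^ m                 ≈⟨ zeroˡ _ ⟩
      0#                         ∎
      where
      open import Algebra.Solver.Ring.NaturalCoefficients.Default commutativeSemiring
      rearrange : ∀ e a c b → (e * (a * c)) * b ≈ (e * (a * b)) * c
      rearrange = solve 4 (λ e a c b → (e :* (a :* c)) :* b := (e :* (a :* b)) :* c) refl

    -- Otherwise cancelling `a` would leave `e` itself equal to zero.
    ∣⇒≉0 : ∀ {a e} → ¬ e ≈ 0# → a ∣ e → ¬ e * a ≈ 0#
    ∣⇒≉0 {a} {e} e≉0 a∣e ea≈0 = e≉0 (trans (sym (*-identityʳ e))
      (∣⇒cancel a∣e 1# (trans (*-congˡ (*-identityʳ a)) ea≈0)))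

-- The ring 𝔽ₚ[X]/(X^N − 1)

module ShiftRing (p′ N′ : ℕ) where

  open import Data.Nat
  open import Data.Nat.Properties
  open import Data.Nat.DivMod
  open ≡ using (refl; sym; trans; cong; cong₂; subst; module ≡-Reasoning)

  p N : ℕ
  p = suc p′
  N = suc N′

  infix 4 _≡ₚ_
  -- A record rather than a bare equation of remainders, so that `m` and `n` can be inferred from a
  -- proof.
  record _≡ₚ_ (m n : ℕ) : Set where
    constructor mod
    field rem : m % p ≡ n % p
  open _≡ₚ_ public

  ≡ₚ-reflexive : ∀ {m n} → m ≡ n → m ≡ₚ n
  ≡ₚ-reflexive refl = mod refl

  ≡ₚ-sym : ∀ {m n} → m ≡ₚ n → n ≡ₚ m
  ≡ₚ-sym (mod e) = mod (sym e)

  ≡ₚ-trans : ∀ {m n o} → m ≡ₚ n → n ≡ₚ o → m ≡ₚ o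
  ≡ₚ-trans (mod e) (mod f) = mod (trans e f)

  +-cong-≡ₚ : ∀ {a b c d} → a ≡ₚ b → c ≡ₚ d → a + c ≡ₚ b + d
  +-cong-≡ₚ {a} {b} {c} {d} (mod e) (mod f) = mod (begin
    (a + c) % p            ≡⟨ %-distribˡ-+ a c p ⟩
    (a % p + c % p) % p    ≡⟨ cong₂ (λ x y → (x + y) % p) e f ⟩
    (b % p + d % p) % p    ≡⟨ %-distribˡ-+ b d p ⟨
    (b + d) % p            ∎)
    where open ≡-Reasoning

  *-congˡ-≡ₚ : ∀ k {a b} → a ≡ₚ b → k * a ≡ₚ k * b
  *-congˡ-≡ₚ zero    e = mod refl
  *-congˡ-≡ₚ (suc k) e = +-cong-≡ₚ e (*-congˡ-≡ₚ k e)

  p*-≡ₚ0 : ∀ a → p * a ≡ₚ 0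
  p*-≡ₚ0 a = mod (trans (cong (_% p) (*-comm p a)) (m*n%n≡0 a p))

  -- A polynomial in X acts on sequences with X as the shift, and equality is agreement modulo p on
  -- the impulse δ of period N, whose annihilator modulo p is generated by X^N − 1.  This makes all
  -- ring laws pointwise identities in ℕ and equality decidable.
  infixl 6 _⊕_
  infixl 7 _⊗_

  data Expr : Set where
    𝟎 𝟏 X   : Expr
    _⊕_ _⊗_ : Expr → Expr → Expr

  ⟦_⟧ : Expr → (ℕ → ℕ) → ℕ → ℕ
  ⟦ 𝟎 ⟧     v n = 0
  ⟦ 𝟏 ⟧     v n = v n
  ⟦ X ⟧     v n = v (suc n)
  ⟦ a ⊕ b ⟧ v n = ⟦ a ⟧ v n + ⟦ b ⟧ v n
  ⟦ a ⊗ b ⟧ v   = ⟦ a ⟧ (⟦ b ⟧ v)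

  ⟦⟧-cong : ∀ a {v w} → (∀ n → v n ≡ w n) → ∀ n → ⟦ a ⟧ v n ≡ ⟦ a ⟧ w n
  ⟦⟧-cong 𝟎       e n = refl
  ⟦⟧-cong 𝟏       e n = e n
  ⟦⟧-cong X       e n = e (suc n)
  ⟦⟧-cong (a ⊕ b) e n = cong₂ _+_ (⟦⟧-cong a e n) (⟦⟧-cong b e n)
  ⟦⟧-cong (a ⊗ b) e n = ⟦⟧-cong a (⟦⟧-cong b e) n

  ⟦⟧-cong-≡ₚ : ∀ a {v w} → (∀ n → v n ≡ₚ w n) → ∀ n → ⟦ a ⟧ v n ≡ₚ ⟦ a ⟧ w n
  ⟦⟧-cong-≡ₚ 𝟎       e n = mod refl
  ⟦⟧-cong-≡ₚ 𝟏       e n = e n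
  ⟦⟧-cong-≡ₚ X       e n = e (suc n)
  ⟦⟧-cong-≡ₚ (a ⊕ b) e n = +-cong-≡ₚ (⟦⟧-cong-≡ₚ a e n) (⟦⟧-cong-≡ₚ b e n)
  ⟦⟧-cong-≡ₚ (a ⊗ b) e n = ⟦⟧-cong-≡ₚ a (⟦⟧-cong-≡ₚ b e) n

  ⟦⟧-0 : ∀ a n → ⟦ a ⟧ (λ _ → 0) n ≡ 0
  ⟦⟧-0 𝟎       n = refl
  ⟦⟧-0 𝟏       n = refl
  ⟦⟧-0 X       n = refl
  ⟦⟧-0 (a ⊕ b) n = cong₂ _+_ (⟦⟧-0 a n) (⟦⟧-0 b n)
  ⟦⟧-0 (a ⊗ b) n = trans (⟦⟧-cong a (⟦⟧-0 b) n) (⟦⟧-0 a n)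

  ⟦⟧-+ : ∀ a v w n → ⟦ a ⟧ (λ i → v i + w i) n ≡ ⟦ a ⟧ v n + ⟦ a ⟧ w n
  ⟦⟧-+ 𝟎       v w n = refl
  ⟦⟧-+ 𝟏       v w n = refl
  ⟦⟧-+ X       v w n = refl
  ⟦⟧-+ (a ⊕ b) v w n = trans (cong₂ _+_ (⟦⟧-+ a v w n) (⟦⟧-+ b v w n))
    (+-interchange (⟦ a ⟧ v n) (⟦ a ⟧ w n) (⟦ b ⟧ v n) (⟦ b ⟧ w n))
    where open import Algebra.Properties.CommutativeSemigroup +-commutativeSemigroup renaming (interchange to +-interchange)
  ⟦⟧-+ (a ⊗ b) v w n = trans (⟦⟧-cong a (⟦⟧-+ b v w) n) (⟦⟧-+ a (⟦ b ⟧ v) (⟦ b ⟧ w) n)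

  ⟦⟧-shift : ∀ a v m n → ⟦ a ⟧ (λ i → v (m + i)) n ≡ ⟦ a ⟧ v (m + n)
  ⟦⟧-shift 𝟎       v m n = refl
  ⟦⟧-shift 𝟏       v m n = refl
  ⟦⟧-shift X       v m n = cong v (+-suc m n)
  ⟦⟧-shift (a ⊕ b) v m n = cong₂ _+_ (⟦⟧-shift a v m n) (⟦⟧-shift b v m n)
  ⟦⟧-shift (a ⊗ b) v m n = trans (⟦⟧-cong a (⟦⟧-shift b v m) n) (⟦⟧-shift a (⟦ b ⟧ v) m n)

  -- Every operator is additive and commutes with shifts, and all of them are built from the shift
  -- by sums and composition.
  ⟦⟧-comm : ∀ a b v n → ⟦ a ⟧ (⟦ b ⟧ v) n ≡ ⟦ b ⟧ (⟦ a ⟧ v) n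
  ⟦⟧-comm 𝟎       b v n = sym (⟦⟧-0 b n)
  ⟦⟧-comm 𝟏       b v n = refl
  ⟦⟧-comm X       b v n = sym (⟦⟧-shift b v 1 n)
  ⟦⟧-comm (a ⊕ c) b v n = trans (cong₂ _+_ (⟦⟧-comm a b v n) (⟦⟧-comm c b v n)) (sym (⟦⟧-+ b (⟦ a ⟧ v) (⟦ c ⟧ v) n))
  ⟦⟧-comm (a ⊗ c) b v n = trans (⟦⟧-cong a (⟦⟧-comm c b v) n) (⟦⟧-comm a b (⟦ c ⟧ v) n)

  indicator₀ : ℕ → ℕ
  indicator₀ zero    = 1
  indicator₀ (suc _) = 0

  δ : ℕ → ℕ
  δ n = indicator₀ (n % N)

  infix 4 _≈_
  record _≈_ (a b : Expr) : Set where
    constructor pointwise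
    field at : ∀ n → ⟦ a ⟧ δ n ≡ₚ ⟦ b ⟧ δ n
  open _≈_ public

  ≡⇒≈ : ∀ {a b} → (∀ n → ⟦ a ⟧ δ n ≡ ⟦ b ⟧ δ n) → a ≈ b
  ≡⇒≈ e = pointwise λ n → ≡ₚ-reflexive (e n)

  infixr 8 _·_
  _·_ : ℕ → Expr → Expr
  zero  · a = 𝟎
  suc k · a = a ⊕ k · a

  ⟦⟧-· : ∀ k a v n → ⟦ k · a ⟧ v n ≡ k * ⟦ a ⟧ v n
  ⟦⟧-· zero    a v n = refl
  ⟦⟧-· (suc k) a v n = cong (⟦ a ⟧ v n +_) (⟦⟧-· k a v n)

  p·a≈0 : ∀ a → p · a ≈ 𝟎
  p·a≈0 a = pointwise λ n → ≡ₚ-trans (≡ₚ-reflexive (⟦⟧-· p a δ n)) (p*-≡ₚ0 (⟦ a ⟧ δ n))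

  -- Since `p′ = p − 1` is -1 modulo `p`, negation needs no negative sequence values.
  ⊖_ : Expr → Expr
  ⊖ a = p′ · a

  shiftRing : CommutativeRing 0ℓ 0ℓ
  shiftRing = record
    { Carrier = Expr
    ; _≈_ = _≈_
    ; _+_ = _⊕_ ; _*_ = _⊗_ ; -_ = ⊖_ ; 0# = 𝟎 ; 1# = 𝟏
    ; isCommutativeRing = record
      { isRing = record
        { +-isAbelianGroup = record
          { isGroup = record
            { isMonoid = record
              { isSemigroup = record
                { isMagma = record
                  { isEquivalence = record
                    { refl  = pointwise λ n → mod refl
                    ; sym   = λ e → pointwise λ n → ≡ₚ-sym (at e n)
                    ; trans = λ e f → pointwise λ n → ≡ₚ-trans (at e n) (at f n)
                    }
                  ; ∙-cong = λ e f → pointwise λ n → +-cong-≡ₚ (at e n) (at f n)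
                  }
                ; assoc = λ a b c → ≡⇒≈ λ n → +-assoc (⟦ a ⟧ δ n) (⟦ b ⟧ δ n) (⟦ c ⟧ δ n)
                }
              ; identity = (λ a → ≡⇒≈ λ n → refl) , (λ a → ≡⇒≈ λ n → +-identityʳ (⟦ a ⟧ δ n))
              }
            ; inverse = (λ a → pointwise λ n → ≡ₚ-trans (≡ₚ-reflexive (+-comm (⟦ ⊖ a ⟧ δ n) (⟦ a ⟧ δ n))) (at (p·a≈0 a) n)) , p·a≈0
            ; ⁻¹-cong = λ {a} {b} e → pointwise λ n → ≡ₚ-trans (≡ₚ-reflexive (⟦⟧-· p′ a δ n))
                (≡ₚ-trans (*-congˡ-≡ₚ p′ (at e n)) (≡ₚ-reflexive (sym (⟦⟧-· p′ b δ n))))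
            }
          ; comm = λ a b → ≡⇒≈ λ n → +-comm (⟦ a ⟧ δ n) (⟦ b ⟧ δ n)
          }
        -- The hypothesis on `a` and `b` speaks only of `δ`, so commutativity first moves `a` next
        -- to `δ`.
        ; *-cong = λ {a} {b} {c} {d} e f → pointwise λ n →
            ≡ₚ-trans (⟦⟧-cong-≡ₚ a (at f) n)
            (≡ₚ-trans (≡ₚ-reflexive (⟦⟧-comm a d δ n))
            (≡ₚ-trans (⟦⟧-cong-≡ₚ d (at e) n) (≡ₚ-reflexive (⟦⟧-comm d b δ n))))
        ; *-assoc = λ a b c → ≡⇒≈ λ n → refl
        ; *-identity = (λ a → ≡⇒≈ λ n → refl) , (λ a → ≡⇒≈ λ n → refl)
        ; distrib = (λ a b c → ≡⇒≈ λ n → ⟦⟧-+ a (⟦ b ⟧ δ) (⟦ c ⟧ δ) n) , (λ a b c → ≡⇒≈ λ n → refl)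
        }
      ; *-comm = λ a b → ≡⇒≈ λ n → ⟦⟧-comm a b δ n
      }
    }

  open import Algebra.Definitions.RawSemiring (Semiring.rawSemiring (CommutativeRing.semiring shiftRing)) using () renaming (_×_ to _×′_; _^_ to _^′_)

  ×′≡· : ∀ k a → k ×′ a ≡ k · a
  ×′≡· zero    a = refl
  ×′≡· (suc k) a = cong (a ⊕_) (×′≡· k a)

  p×1≈0 : p ×′ 𝟏 ≈ 𝟎
  p×1≈0 = subst (_≈ 𝟎) (sym (×′≡· p 𝟏)) (p·a≈0 𝟏)

  ⟦X^⟧ : ∀ k v n → ⟦ X ^′ k ⟧ v n ≡ v (k + n)
  ⟦X^⟧ zero    v n = refl
  ⟦X^⟧ (suc k) v n = trans (⟦X^⟧ k v (suc n)) (cong v (+-suc k n))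

  δ-periodic : ∀ n → δ (N + n) ≡ δ n
  δ-periodic n = cong indicator₀ ([m+n]%m≡n%m N n)
    where
    [m+n]%m≡n%m : ∀ m n .{{_ : NonZero m}} → (m + n) % m ≡ n % m
    [m+n]%m≡n%m m n = trans (cong (_% m) (+-comm m n)) ([m+n]%n≡m%n n m)

  X^[1+N]≈X : X ^′ suc N ≈ X
  X^[1+N]≈X = ≡⇒≈ λ n → trans (⟦X^⟧ (suc N) δ n) (trans (cong δ (sym (+-suc N n))) (δ-periodic (suc n)))

  ⟦⟧δ-periodic : ∀ a n → ⟦ a ⟧ δ (N + n) ≡ ⟦ a ⟧ δ n
  ⟦⟧δ-periodic a n = trans (sym (⟦⟧-shift a δ N n)) (⟦⟧-cong a δ-periodic n)

  ⟦⟧δ-% : ∀ a n → ⟦ a ⟧ δ n ≡ ⟦ a ⟧ δ (n % N)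
  ⟦⟧δ-% a n = trans (cong (⟦ a ⟧ δ) (trans (m≡m%n+[m/n]*n n N) (+-comm (n % N) _))) (go (n / N) (n % N))
    where
    go : ∀ k m → ⟦ a ⟧ δ (k * N + m) ≡ ⟦ a ⟧ δ m
    go zero    m = refl
    go (suc k) m = trans (cong (⟦ a ⟧ δ) (+-assoc N (k * N) m)) (trans (⟦⟧δ-periodic a (k * N + m)) (go k m))

  ≈-on-period : ∀ {a b} → (∀ n → n < N → ⟦ a ⟧ δ n ≡ₚ ⟦ b ⟧ δ n) → a ≈ b
  ≈-on-period {a} {b} e = pointwise λ n → ≡ₚ-trans (≡ₚ-reflexive (⟦⟧δ-% a n))
    (≡ₚ-trans (e (n % N) (m%n<n n N)) (≡ₚ-reflexive (sym (⟦⟧δ-% b n))))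

  _≈?_ : Decidable _≈_
  a ≈? b = map′
    (λ e → ≈-on-period λ n n<N → subst (λ m → ⟦ a ⟧ δ m ≡ₚ ⟦ b ⟧ δ m) (Fin.toℕ-fromℕ< n<N) (mod (e (fromℕ< n<N))))
    (λ e i → rem (at e (toℕ i)))
    (Fin.all? {n = N} λ i → (⟦ a ⟧ δ (toℕ i) % p) ≟ (⟦ b ⟧ δ (toℕ i) % p))

  δ[0<n<N]≡0 : ∀ {n} → 0 < n → n < N → δ n ≡ 0
  δ[0<n<N]≡0 {suc n} _ n<N = cong indicator₀ (m<n⇒m%n≡m n<N)

  δN≡1 : δ N ≡ 1
  δN≡1 = cong indicator₀ (n%n≡0 N)

  -- At `N` these are the combinations of X^N, ..., X^1 with coefficients below `p`, which represent
  -- every class of the ring.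
  candidates : ℕ → List Expr
  candidates zero    = 𝟎 ∷ []
  candidates (suc m) = cartesianProductWith (λ g k → g ⊕ k · (X ^′ (N ∸ m))) (candidates m) (upTo p)

  -- X ^ (N ∸ m) sends δ to a sequence vanishing below m with value 1 at m, so the
  -- values of a candidate can be adjusted one index at a time.
  approximate : ∀ a m → m ≤ N → ∃[ g ] g List.∈ candidates m × (∀ n → n < m → ⟦ a ⟧ δ n ≡ₚ ⟦ g ⟧ δ n)
  approximate a zero    _   = 𝟎 , here refl , λ _ ()
  approximate a (suc m) m<N with g , g∈ , a≡g ← approximate a m (<⇒≤ m<N) =
    g ⊕ k · (X ^′ (N ∸ m)) , ∈-cartesianProductWith⁺ _ g∈ (∈-upTo⁺ (m%n<n (A + p′ * G) p)) , agree
    where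
    A = ⟦ a ⟧ δ m
    G = ⟦ g ⟧ δ m
    -- The residue of A - G, the correction still missing at index `m`.
    k = (A + p′ * G) % p
    value : ∀ n → ⟦ k · (X ^′ (N ∸ m)) ⟧ δ n ≡ k * δ (N ∸ m + n)
    value n = trans (⟦⟧-· k (X ^′ (N ∸ m)) δ n) (cong (k *_) (⟦X^⟧ (N ∸ m) δ n))
    agree : ∀ n → n < suc m → ⟦ a ⟧ δ n ≡ₚ ⟦ g ⟧ δ n + ⟦ k · (X ^′ (N ∸ m)) ⟧ δ n
    agree n n<1+m with m≤n⇒m<n∨m≡n (≤-pred n<1+m)
    ... | inj₁ n<m = ≡ₚ-trans (a≡g n n<m) (≡ₚ-reflexive (sym (begin
      ⟦ g ⟧ δ n + ⟦ k · (X ^′ (N ∸ m)) ⟧ δ n  ≡⟨ cong (⟦ g ⟧ δ n +_) (value n) ⟩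
      ⟦ g ⟧ δ n + k * δ (N ∸ m + n)  ≡⟨ cong (λ z → ⟦ g ⟧ δ n + k * z) (δ[0<n<N]≡0
          (≤-trans (m<n⇒0<n∸m m<N) (m≤m+n (N ∸ m) n))
          (<-≤-trans (+-monoʳ-< (N ∸ m) n<m) (≤-reflexive (m∸n+n≡m (<⇒≤ m<N))))) ⟩
      ⟦ g ⟧ δ n + k * 0              ≡⟨ cong (⟦ g ⟧ δ n +_) (*-zeroʳ k) ⟩
      ⟦ g ⟧ δ n + 0                  ≡⟨ +-identityʳ _ ⟩
      ⟦ g ⟧ δ n                      ∎)))
      where open ≡-Reasoning
    ... | inj₂ refl = ≡ₚ-sym (≡ₚ-trans (≡ₚ-reflexive (cong (G +_) (begin
      ⟦ k · (X ^′ (N ∸ m)) ⟧ δ n     ≡⟨ value n ⟩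
      k * δ (N ∸ n + n)              ≡⟨ cong (λ z → k * δ z) (m∸n+n≡m (<⇒≤ m<N)) ⟩
      k * δ N                        ≡⟨ cong (k *_) δN≡1 ⟩
      k * 1                          ≡⟨ *-identityʳ k ⟩
      k                              ∎)))
      (≡ₚ-trans (+-cong-≡ₚ {G} {G} (mod refl) (mod (m%n%n≡m%n (A + p′ * G) p)))
      (≡ₚ-trans (≡ₚ-reflexive (x∙yz≈y∙xz G A (p′ * G)))
      (≡ₚ-trans (+-cong-≡ₚ {A} {A} (mod refl) (p*-≡ₚ0 G)) (≡ₚ-reflexive (+-identityʳ A))))))
      where
      open ≡-Reasoning
      open import Algebra.Properties.CommutativeSemigroup +-commutativeSemigroup using (x∙yz≈y∙xz)

  finite : ∀ a → ∃[ g ] g List.∈ candidates N × a ≈ g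
  finite a with g , g∈ , e ← approximate a N ≤-refl = g , g∈ , ≈-on-period e

  -- Only values of v that are assumed to vanish are seen by the lower-order terms of a.
  Monic : ℕ → Expr → Set
  Monic D a = ∀ v n → (∀ j → j < D → v (j + n) ≡ₚ 0) → ⟦ a ⟧ v n ≡ₚ v (D + n)

  -- On the window from `n` to `D + n` the sequence `⟦ b ⟧ v` is `v` moved by `E`, so the `D` values
  -- that must vanish for `a` are values of `v` at offsets `E` up to `D + E − 1`.
  monic-⊗ : ∀ {D E a b} → Monic D a → Monic E b → Monic (D + E) (a ⊗ b)
  monic-⊗ {D} {E} {a} {b} ma mb v n v≡0 = ≡ₚ-trans
    (ma (⟦ b ⟧ v) n λ j j<D → ≡ₚ-trans (b≡ j (<⇒≤ j<D)) (≡ₚ-trans (≡ₚ-reflexive (cong v (rearr j))) (v≡0 (j + E) (+-monoˡ-< E j<D))))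
    (≡ₚ-trans (b≡ D ≤-refl) (≡ₚ-reflexive (cong v (rearr D))))
    where
    rearr : ∀ j → E + (j + n) ≡ (j + E) + n
    rearr j = trans (sym (+-assoc E j n)) (cong (_+ n) (+-comm E j))
    b≡ : ∀ j → j ≤ D → ⟦ b ⟧ v (j + n) ≡ₚ v (E + (j + n))
    b≡ j j≤D = mb v (j + n) λ i i<E → ≡ₚ-trans (≡ₚ-reflexive (cong v (sym (+-assoc i j n))))
      (v≡0 (i + j) (subst (i + j <_) (+-comm E D) (+-mono-<-≤ i<E j≤D)))

  -- For `1 < D` the term -X reads `v` at offset 1, inside the range where it vanishes.
  monic-X^-X : ∀ {D} → 1 < D → Monic D (X ^′ D ⊕ ⊖ X)
  monic-X^-X {D} 1<D v n v≡0 = ≡ₚ-trans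
    (+-cong-≡ₚ (≡ₚ-reflexive (⟦X^⟧ D v n))
      (≡ₚ-trans (≡ₚ-reflexive (⟦⟧-· p′ X v n)) (≡ₚ-trans (*-congˡ-≡ₚ p′ (v≡0 1 1<D)) (≡ₚ-reflexive (*-zeroʳ p′)))))
    (≡ₚ-reflexive (+-identityʳ _))

  -- At index `N ∸ D` the operator sees `D` zeros of `δ` followed by `δ N = 1`, so it takes the
  -- value 1 there.
  monic⇒≉0 : 1 < p → ∀ {D a} → D < N → Monic D a → ¬ a ≈ 𝟎
  monic⇒≉0 1<p {D} {a} D<N ma a≈0 = 1+n≢0 (trans (sym (m<n⇒m%n≡m 1<p)) (rem 1≡0))
    where
    n = N ∸ D
    1≡0 : 1 ≡ₚ 0
    1≡0 = ≡ₚ-trans (≡ₚ-reflexive (trans (sym δN≡1) (cong δ (sym (m+[n∸m]≡n (<⇒≤ D<N))))))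
      (≡ₚ-trans (≡ₚ-sym (ma δ n λ j j<D → ≡ₚ-reflexive (δ[0<n<N]≡0
        (≤-trans (m<n⇒0<n∸m D<N) (m≤n+m n j))
        (<-≤-trans (+-monoˡ-< n j<D) (≤-reflexive (m+[n∸m]≡n (<⇒≤ D<N)))))))
      (at a≈0 n))

-- Finite fields

-- A finite field is encoded as a domain whose classes under `≈` are enumerated by `Fin q`; `domain`
-- is the form in which root counting uses it.
record GaloisField (q : ℕ) : Set₁ where
  field
    ring : CommutativeRing 0ℓ 0ℓ
  open CommutativeRing ring
  field
    domain         : ∀ x y → x * y ≈ 0# → x ≈ 0# ⊎ y ≈ 0#
    elem           : Fin q → Carrier
    elem-injective : Injective _≡_ _≈_ elem
    index          : Carrier → Fin q
    elem-index     : ∀ x → elem (index x) ≈ x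

funToFin-cong : ∀ {m n} {f g : Fin m → Fin n} → (∀ i → f i ≡ g i) → funToFin f ≡ funToFin g
funToFin-cong {zero}  f≗g = ≡.refl
funToFin-cong {suc m} f≗g = ≡.cong₂ Fin.combine (f≗g zero) (funToFin-cong (f≗g ∘ suc))

finToFun-injective : ∀ {m n} (i j : Fin (m ℕ.^ n)) → (∀ k → finToFun {m} {n} i k ≡ finToFun j k) → i ≡ j
finToFun-injective {m} {n} i j eq = ≡.trans (≡.sym (Fin.funToFin-finToFin {n} {m} i))
  (≡.trans (funToFin-cong eq) (Fin.funToFin-finToFin {n} {m} j))

-- Recognising a field with q elements by conjugates

module Recognition (K : CommutativeRing 0ℓ 0ℓ) where
  open CommutativeRing K hiding (zero)
  open import Algebra.Properties.CommutativeSemiring.Exp commutativeSemiring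
  open import Algebra.Properties.Semiring.Mult semiring renaming (_×_ to _·_)
  open import Algebra.Properties.Group +-group using () renaming (∙-cancelˡ to +-cancelˡ)
  open import Relation.Binary.Reasoning.Setoid setoid
  open Polynomial K
  open Characteristic K

  monomial : ∀ n → Fin (suc n) → Carrier
  monomial zero    _       = 1#
  monomial (suc n) zero    = 0#
  monomial (suc n) (suc i) = monomial n i

  eval-monomial : ∀ n x → eval (monomial n) x ≈ x ^ n
  eval-monomial zero    x = trans (+-congˡ (zeroʳ x)) (+-identityʳ 1#)
  eval-monomial (suc n) x = trans (+-identityˡ _) (*-congˡ (eval-monomial n x))

  monomial-top : ∀ n → monomial n (fromℕ n) ≡ 1#
  monomial-top zero    = ≡.refl
  monomial-top (suc n) = monomial-top n

  -- The polynomial T, padded with zeros for coefficientwise comparison with T^(n+1).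
  identityPoly : ∀ n → Fin (2 ℕ.+ n) → Carrier
  identityPoly n zero          = 0#
  identityPoly n (suc zero)    = 1#
  identityPoly n (suc (suc _)) = 0#

  eval-identityPoly : ∀ n x → eval (identityPoly n) x ≈ x
  eval-identityPoly n x = begin
    0# + x * (1# + x * eval {n} (λ _ → 0#) x)  ≈⟨ +-identityˡ _ ⟩
    x * (1# + x * eval {n} (λ _ → 0#) x)       ≈⟨ *-congˡ (+-congˡ (*-congˡ (eval-0 {n} (λ _ → 0#) x (λ _ → refl)))) ⟩
    x * (1# + x * 0#)                          ≈⟨ *-congˡ (+-congˡ (zeroʳ x)) ⟩
    x * (1# + 0#)                              ≈⟨ *-congˡ (+-identityʳ 1#) ⟩
    x * 1#                                     ≈⟨ *-identityʳ x ⟩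
    x                                          ∎

  module _ (_≟_ : Decidable _≈_) (1≉0 : ¬ 1# ≈ 0#)
           (domain : ∀ x y → x * y ≈ 0# → x ≈ 0# ⊎ y ≈ 0#) where

    -- T^q and T would agree at q + 1 points and hence in every coefficient; for `2 ≤ q` the top one
    -- reads 1 = 0.
    fixedPoints≤ : ∀ {q} → 2 ℕ.≤ q → (∀ x → x ^ q ≈ x) → (xs : Fin (suc q) → Carrier) → ¬ Injective _≡_ _≈_ xs
    fixedPoints≤ {suc (suc m)} (ℕ.s≤s (ℕ.s≤s _)) x^q≈x xs inj = 1≉0 (begin
      1#                         ≡⟨ monomial-top q ⟨
      monomial q (fromℕ q)       ≈⟨ eval-determines domain (monomial q) (identityPoly (suc m)) xs inj
                                     (λ i → trans (eval-monomial q (xs i)) (trans (x^q≈x (xs i)) (sym (eval-identityPoly (suc m) (xs i))))) (fromℕ q) ⟩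
      0#                         ∎)
      where q = suc (suc m)

    module _ {p : ℕ} (pr : Prime p) (p·1≈0 : p · 1# ≈ 0#) where

      -- By Bézout, 1 is the difference between a multiple of `p` and a multiple of `n`, in one
      -- order or the other; both multiples would kill `1#`.
      n·1≉0 : ∀ {n} → 0 ℕ.< n → n ℕ.< p → ¬ n · 1# ≈ 0#
      n·1≉0 {n@(suc _)} _ n<p n·1≈0 with coprime-Bézout (prime⇒coprime pr n<p)
      ... | Bézout.+- x y eq = 1≉0 (begin
        1#                           ≈⟨ +-identityʳ 1# ⟨
        1# + 0#                      ≈⟨ +-congˡ (∣⇒·≈0 n·1≈0 (ℕ.n∣m*n y) 1#) ⟨
        1# + (y ℕ.* n) · 1#          ≡⟨ ≡.cong (_· 1#) eq ⟩
        (x ℕ.* p) · 1#               ≈⟨ ∣⇒·≈0 p·1≈0 (ℕ.n∣m*n x) 1# ⟩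
        0#                           ∎)
      ... | Bézout.-+ x y eq = 1≉0 (begin
        1#                           ≈⟨ +-identityʳ 1# ⟨
        1# + 0#                      ≈⟨ +-congˡ (∣⇒·≈0 p·1≈0 (ℕ.n∣m*n x) 1#) ⟨
        1# + (x ℕ.* p) · 1#          ≡⟨ ≡.cong (_· 1#) eq ⟩
        (y ℕ.* n) · 1#               ≈⟨ ∣⇒·≈0 n·1≈0 (ℕ.n∣m*n y) 1# ⟩
        0#                           ∎)

      ·1-≉ : ∀ {m n} → m ℕ.< n → n ℕ.< p → ¬ m · 1# ≈ n · 1#
      ·1-≉ {m} {n} m<n n<p eq = n·1≉0 (ℕ.m<n⇒0<n∸m m<n) (ℕ.≤-<-trans (ℕ.m∸n≤m n m) n<p)
        (+-cancelˡ (m · 1#) _ _ (begin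
          m · 1# + (n ℕ.∸ m) · 1#   ≈⟨ ×-homo-+ 1# m (n ℕ.∸ m) ⟨
          (m ℕ.+ (n ℕ.∸ m)) · 1#    ≡⟨ ≡.cong (_· 1#) (ℕ.m+[n∸m]≡n (ℕ.<⇒≤ m<n)) ⟩
          n · 1#                    ≈⟨ eq ⟨
          m · 1#                    ≈⟨ +-identityʳ _ ⟨
          m · 1# + 0#               ∎))

      ·1-injective : ∀ {m n} → m ℕ.< p → n ℕ.< p → m · 1# ≈ n · 1# → m ≡ n
      ·1-injective {m} {n} m<p n<p eq with ℕ.<-cmp m n
      ... | tri< m<n _ _ = ⊥-elim (·1-≉ m<n n<p eq)
      ... | tri≈ _ m≡n _ = m≡n
      ... | tri> _ _ n<m = ⊥-elim (·1-≉ n<m m<p (sym eq))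

      -- Frobenius fixes coefficients from the prime field, so it carries the value at `x` to the
      -- value at the conjugate of `x`.
      eval-frobenius : ∀ {k} d (c : Fin k → ℕ) x →
        eval (λ i → c i · 1#) (x ^ (p ℕ.^ d)) ≈ eval (λ i → c i · 1#) x ^ (p ℕ.^ d)
      eval-frobenius {zero}  d c x = sym (0^p^n≈0 pr p·1≈0 d)
      eval-frobenius {suc k} d c x = begin
        c zero · 1# + x ^ P * eval (λ i → c (suc i) · 1#) (x ^ P)
          ≈⟨ +-cong (sym (frobenius^-· pr p·1≈0 d (c zero))) (*-congˡ (eval-frobenius d (c ∘ suc) x)) ⟩
        (c zero · 1#) ^ P + x ^ P * E ^ P    ≈⟨ +-congˡ (^-distrib-* x E P) ⟨
        (c zero · 1#) ^ P + (x * E) ^ P      ≈⟨ frobenius^-+ pr p·1≈0 d _ _ ⟨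
        (c zero · 1# + x * E) ^ P            ∎
        where
        P = p ℕ.^ d
        E = eval (λ i → c (suc i) · 1#) x

      module _ {k : ℕ} (x^q≈x : ∀ x → x ^ (p ℕ.^ k) ≈ x) (2≤q : 2 ℕ.≤ p ℕ.^ k)
               (θ : Carrier) (θ^≉θ : ∀ d → 0 ℕ.< d → d ℕ.< k → ¬ θ ^ (p ℕ.^ d) ≈ θ) where

        -- Raising a coincidence to the power p^(k-i) turns one side into `θ` and the other into
        -- θ^(p^(j-i)), since θ^(p^k) = θ.
        conjugate-≉ : ∀ {i j} → i ℕ.< j → j ℕ.< k → ¬ θ ^ (p ℕ.^ i) ≈ θ ^ (p ℕ.^ j)
        conjugate-≉ {i} {j} i<j j<k eq = θ^≉θ (j ℕ.∸ i) (ℕ.m<n⇒0<n∸m i<j) (ℕ.≤-<-trans (ℕ.m∸n≤m j i) j<k) (begin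
          θ ^ (p ℕ.^ (j ℕ.∸ i))                               ≈⟨ ^-congˡ (p ℕ.^ (j ℕ.∸ i)) (x^q≈x θ) ⟨
          (θ ^ (p ℕ.^ k)) ^ (p ℕ.^ (j ℕ.∸ i))                 ≈⟨ power k (j ℕ.∸ i) ⟩
          θ ^ (p ℕ.^ (k ℕ.+ (j ℕ.∸ i)))                       ≡⟨ ≡.cong (λ z → θ ^ (p ℕ.^ z)) exponents ⟩
          θ ^ (p ℕ.^ (j ℕ.+ (k ℕ.∸ i)))                       ≈⟨ power j (k ℕ.∸ i) ⟨
          (θ ^ (p ℕ.^ j)) ^ (p ℕ.^ (k ℕ.∸ i))                 ≈⟨ ^-congˡ (p ℕ.^ (k ℕ.∸ i)) eq ⟨
          (θ ^ (p ℕ.^ i)) ^ (p ℕ.^ (k ℕ.∸ i))                 ≈⟨ power i (k ℕ.∸ i) ⟩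
          θ ^ (p ℕ.^ (i ℕ.+ (k ℕ.∸ i)))                       ≡⟨ ≡.cong (λ z → θ ^ (p ℕ.^ z)) (ℕ.m+[n∸m]≡n i≤k) ⟩
          θ ^ (p ℕ.^ k)                                       ≈⟨ x^q≈x θ ⟩
          θ                                                   ∎)
          where
          i≤k = ℕ.<⇒≤ (ℕ.<-trans i<j j<k)
          power : ∀ a b → (θ ^ (p ℕ.^ a)) ^ (p ℕ.^ b) ≈ θ ^ (p ℕ.^ (a ℕ.+ b))
          power a b = trans (^-assocʳ θ (p ℕ.^ a) (p ℕ.^ b)) (^-congʳ θ (≡.sym (ℕ.^-distribˡ-+-* p a b)))
          exponents : k ℕ.+ (j ℕ.∸ i) ≡ j ℕ.+ (k ℕ.∸ i)
          exponents = ≡.trans (≡.sym (ℕ.+-∸-assoc k (ℕ.<⇒≤ i<j)))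
            (≡.trans (≡.cong (ℕ._∸ i) (ℕ.+-comm k j)) (ℕ.+-∸-assoc j i≤k))

        conjugates-injective : Injective _≡_ _≈_ (λ (i : Fin k) → θ ^ (p ℕ.^ toℕ i))
        conjugates-injective {i} {j} eq with ℕ.<-cmp (toℕ i) (toℕ j)
        ... | tri< i<j _ _ = ⊥-elim (conjugate-≉ i<j (Fin.toℕ<n j) eq)
        ... | tri≈ _ i≡j _ = Fin.toℕ-injective i≡j
        ... | tri> _ _ j<i = ⊥-elim (conjugate-≉ j<i (Fin.toℕ<n i) (sym eq))

        digits : Fin (p ℕ.^ k) → Fin k → ℕ
        digits i j = toℕ (finToFun {p} {k} i j)

        combination : Fin (p ℕ.^ k) → Carrier
        combination i = eval (λ j → digits i j · 1#) θ

        -- Equal values at `θ` give equal values at all `k` conjugates, which determine the `k`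
        -- coefficients; these in turn determine the base-`p` digits.
        combination-injective : Injective _≡_ _≈_ combination
        combination-injective {i} {i′} eq = finToFun-injective {p} {k} i i′ λ j →
          Fin.toℕ-injective (·1-injective (Fin.toℕ<n (finToFun {p} {k} i j)) (Fin.toℕ<n (finToFun {p} {k} i′ j))
            (eval-determines domain (λ j → digits i j · 1#) (λ j → digits i′ j · 1#) (λ j → θ ^ (p ℕ.^ toℕ j)) conjugates-injective
              (λ j → trans (eval-frobenius (toℕ j) (digits i) θ)
                (trans (^-congˡ (p ℕ.^ toℕ j) eq) (sym (eval-frobenius (toℕ j) (digits i′) θ)))) j))

        -- A missed `x` together with all combinations would give q + 1 distinct roots of T^q - T.
        combination-surjective : ∀ x → ∃[ i ] combination i ≈ x
        combination-surjective x with Fin.any? (λ i → combination i ≟ x)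
        ... | yes found = found
        ... | no  ∄i    = ⊥-elim (fixedPoints≤ 2≤q x^q≈x xs xs-injective)
          where
          xs : Fin (suc (p ℕ.^ k)) → Carrier
          xs zero    = x
          xs (suc i) = combination i
          xs-injective : Injective _≡_ _≈_ xs
          xs-injective {zero}  {zero}  eq = ≡.refl
          xs-injective {zero}  {suc j} eq = ⊥-elim (∄i (j , sym eq))
          xs-injective {suc i} {zero}  eq = ⊥-elim (∄i (i , eq))
          xs-injective {suc i} {suc j} eq = ≡.cong suc (combination-injective eq)

        recognize : GaloisField (p ℕ.^ k)
        recognize = record
          { ring           = K
          ; domain         = domain
          ; elem           = combination
          ; elem-injective = combination-injective
          ; index          = λ x → proj₁ (combination-surjective x)
          ; elem-index     = λ x → proj₂ (combination-surjective x)
          }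

1<m⇒1<m^[1+k] : ∀ {m} → 1 ℕ.< m → ∀ k → 1 ℕ.< m ℕ.^ suc k
1<m⇒1<m^[1+k] {m@(suc _)} 1<m k = ℕ.≤-trans 1<m (ℕ.m≤m*n m (m ℕ.^ k) {{ℕ.m^n≢0 m k}})

-- Construction of the field of prime power order

module Construction (p′ k N′ : ℕ) (pr : Prime (suc p′)) (2+N′≡q : suc (suc N′) ≡ suc p′ ℕ.^ suc k) where
  open ShiftRing p′ N′

  -- The exponent is `suc k`, so `d` runs from 1 to `k` in the product `u k`; `2+N′≡q` makes the
  -- period `N` equal to q - 1.
  q : ℕ
  q = p ℕ.^ suc k

  1<p : 1 ℕ.< p
  1<p = ℕ.nonTrivial⇒n>1 p {{prime⇒nonTrivial pr}}

  open CommutativeRing shiftRing using (_*_; 0#; 1#; _-_; commutativeSemiring; *-commutativeSemigroup; semiring; refl; sym; trans; +-cong; *-cong; *-congˡ; *-congʳ; *-assoc; zeroʳ; *-identityʳ)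
  open import Algebra.Properties.CommutativeSemiring.Exp commutativeSemiring
  open Characteristic shiftRing
  open Annihilator shiftRing

  -- Frobenius respects sums and products, so induction on the expression leads back to the
  -- generator `X`, where the period gives the claim.
  x^q≈x : ∀ a → a ^ q ≈ a
  x^q≈x 𝟎       = 0^p^n≈0 pr p×1≈0 (suc k)
  x^q≈x 𝟏       = 1^n≈1 q
  x^q≈x X       = trans (^-congʳ X (≡.sym 2+N′≡q)) X^[1+N]≈X
  x^q≈x (a ⊕ b) = trans (frobenius^-+ pr p×1≈0 (suc k) a b) (+-cong (x^q≈x a) (x^q≈x b))
  x^q≈x (a ⊗ b) = trans (^-distrib-* a b q) (*-cong (x^q≈x a) (x^q≈x b))

  x^[1+N]≈x : ∀ a → a ^ suc N ≈ a
  x^[1+N]≈x a = trans (^-congʳ a 2+N′≡q) (x^q≈x a)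

  factor : ℕ → Expr
  factor d = X ^ (p ℕ.^ d) - X

  u : ℕ → Expr
  u zero    = 1#
  u (suc j) = factor (suc j) * u j

  degree : ℕ → ℕ
  degree zero    = 0
  degree (suc j) = p ℕ.^ suc j ℕ.+ degree j

  u-monic : ∀ j → Monic (degree j) (u j)
  u-monic zero    v n _ = mod ≡.refl
  u-monic (suc j) = monic-⊗ {p ℕ.^ suc j} {degree j} {factor (suc j)} {u j} (monic-X^-X (1<m⇒1<m^[1+k] 1<p j)) (u-monic j)

  -- Doubling stays below multiplication by `p`. The slack of 2 gives `degree k < N`, as `N` is q -
  -- 1.
  degree-bound : ∀ j → degree j ℕ.+ 2 ℕ.≤ p ℕ.^ suc j
  degree-bound zero    = 1<m⇒1<m^[1+k] 1<p 0
  degree-bound (suc j) = begin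
    p ℕ.^ suc j ℕ.+ degree j ℕ.+ 2      ≡⟨ ℕ.+-assoc (p ℕ.^ suc j) (degree j) 2 ⟩
    p ℕ.^ suc j ℕ.+ (degree j ℕ.+ 2)    ≤⟨ ℕ.+-monoʳ-≤ (p ℕ.^ suc j) (degree-bound j) ⟩
    p ℕ.^ suc j ℕ.+ p ℕ.^ suc j         ≡⟨ ≡.cong (p ℕ.^ suc j ℕ.+_) (ℕ.+-identityʳ _) ⟨
    2 ℕ.* p ℕ.^ suc j                   ≤⟨ ℕ.*-monoˡ-≤ (p ℕ.^ suc j) 1<p ⟩
    p ℕ.* p ℕ.^ suc j                   ∎
    where open ℕ.≤-Reasoning

  u≉0 : ¬ u k ≈ 0#
  u≉0 = monic⇒≉0 1<p {degree k} {u k} (ℕ.≤-pred (ℕ.≤-trans (ℕ.≤-reflexive (ℕ.+-comm 2 (degree k)))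
    (ℕ.≤-trans (degree-bound k) (ℕ.≤-reflexive (≡.sym 2+N′≡q))))) (u-monic k)

  factor∣u : ∀ d j → suc d ℕ.≤ j → factor (suc d) ∣ u j
  factor∣u d (suc j) (ℕ.s≤s d≤j) with ℕ.m≤n⇒m<n∨m≡n d≤j
  ... | inj₂ ≡.refl = u j , refl
  ... | inj₁ d<j with z , eq ← factor∣u d j d<j = factor (suc j) * z , trans (x∙yz≈y∙xz _ _ _) (*-congˡ eq)
    where open import Algebra.Properties.CommutativeSemigroup *-commutativeSemigroup using (x∙yz≈y∙xz)

  module Quotient (e : Expr) (e≉0 : ¬ e ≈ 0#) (u∣e : u k ∣ e) (dichotomy : ∀ a → e * a ≈ 0# ⊎ a ∣ e) where

    factor∣e : ∀ d → suc d ℕ.≤ k → factor (suc d) ∣ e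
    factor∣e d d<k = let z , eq = factor∣u d k d<k ; w , eq′ = u∣e in
      z * w , trans (sym (*-assoc _ z w)) (trans (*-congʳ eq) eq′)

    K = modAnnihilator e
    module K = CommutativeRing K
    open import Algebra.Definitions.RawSemiring (Semiring.rawSemiring K.semiring) using () renaming (_^_ to _^ₖ_; _×_ to _×ₖ_)
    open import Algebra.Definitions.RawSemiring (Semiring.rawSemiring semiring) using () renaming (_×_ to _×ᵣ_)

    -- Not definitional: the two bundles differ in their equality.
    ^ₖ≡^ : ∀ a n → a ^ₖ n ≡ a ^ n
    ^ₖ≡^ a zero    = ≡.refl
    ^ₖ≡^ a (suc n) = ≡.cong (a *_) (^ₖ≡^ a n)

    ×ₖ≡× : ∀ n a → n ×ₖ a ≡ n ×ᵣ a
    ×ₖ≡× zero    a = ≡.refl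
    ×ₖ≡× (suc n) a = ≡.cong (a ⊕_) (×ₖ≡× n a)

    _≈ₖ?_ : Decidable K._≈_
    a ≈ₖ? b = (e * a) ≈? (e * b)

    1≉0 : ¬ 1# K.≈ 0#
    1≉0 eq = e≉0 (trans (sym (*-identityʳ e)) (trans eq (zeroʳ e)))

    -- An element annihilated by `e` is zero in `K`, and a divisor of `e` can be cancelled.
    domain : ∀ a b → a * b K.≈ 0# → a K.≈ 0# ⊎ b K.≈ 0#
    domain a b ab≈0 with dichotomy a
    ... | inj₁ ea≈0 = inj₁ (trans ea≈0 (sym (zeroʳ e)))
    ... | inj₂ a∣e  = inj₂ (trans (∣⇒cancel N′ x^[1+N]≈x a∣e b (trans ab≈0 (zeroʳ e))) (sym (zeroʳ e)))

    p×1≈ₖ0 : p ×ₖ 1# K.≈ 0#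
    p×1≈ₖ0 = *-congˡ (≡.subst (_≈ 0#) (≡.sym (×ₖ≡× p 1#)) p×1≈0)

    x^q≈ₖx : ∀ a → (a ^ₖ q) K.≈ a
    x^q≈ₖx a = *-congˡ (≡.subst (_≈ a) (≡.sym (^ₖ≡^ a q)) (x^q≈x a))

    -- The factor X^(p^d) - X divides `u k` and hence the non-zero `e`, so it is not annihilated by
    -- `e`.
    X^≉X : ∀ d → 0 ℕ.< d → d ℕ.< suc k → ¬ (X ^ₖ (p ℕ.^ d)) K.≈ X
    X^≉X (suc d) _ (ℕ.s≤s d<k) eq = ∣⇒≉0 N′ x^[1+N]≈x e≉0 (factor∣e d d<k)
      (trans (x≈y⇒x∙y⁻¹≈ε (≡.subst (K._≈ X) (^ₖ≡^ X (p ℕ.^ suc d)) eq)) (zeroʳ e))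
      where open import Algebra.Properties.Group K.+-group using (x≈y⇒x∙y⁻¹≈ε)

    quotientField : GaloisField q
    quotientField = Recognition.recognize K _≈ₖ?_ 1≉0 domain pr p×1≈ₖ0 {suc k} x^q≈ₖx (1<m⇒1<m^[1+k] 1<p k) X X^≉X

  constructed : GaloisField q
  constructed with e , e≉0 , u∣e , all ← saturate _≈?_ (candidates N) (u k) u≉0 =
    -- The dichotomy is invariant under `≈`, so the finitely many representatives in `candidates N`
    -- suffice.
    Quotient.quotientField e e≉0 u∣e λ a → let g , g∈ , a≈g = finite a in
      Sum.map (trans (*-congˡ a≈g)) (λ (z , eq) → z , trans (*-congʳ a≈g) eq) (All.lookup all g∈)

galoisField : ∀ {p} → Prime p → ∀ k → GaloisField (p ℕ.^ suc k)
galoisField {zero}   pr k = ⊥-elim (¬prime[0] pr)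
galoisField {suc p′} pr k = Construction.constructed p′ k (suc p′ ℕ.^ suc k ℕ.∸ 2) pr
  (ℕ.m+[n∸m]≡n (1<m⇒1<m^[1+k] (ℕ.nonTrivial⇒n>1 (suc p′) {{prime⇒nonTrivial pr}}) k))

-- Codes and cover-free families

open import Data.Fin.Properties using (_≟_)
open import Data.Fin.Relation.Unary.Top using (view; ‵fromℕ; ‵inject₁)
open import Data.Fin.Subset using (Subset; inside; outside; _∈_; _∩_; _─_; _-_; ⋃; ∣_∣)
open import Data.Fin.Subset.Properties using (p─⊥≡p; p─q─r≡p─q∪r; p─q⊆p; x∈p∩q⁺; x∈p∩q⁻; p⊆q⇒∣p∣≤∣q∣; x∈p∧x≢y⇒x∈p-y; x∈p⇒∣p-x∣<∣p∣)
open import Data.Nat.DivMod using (_/_; m/n*n≤m)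
open import Data.Vec as Vec using ([]; _∷_; here; there)
open import Data.Vec.Properties using (lookup∘tabulate; []=⇒lookup; lookup⇒[]=)
open import Data.Nat using (_+_; _*_; _∸_; _^_; _≤_; _<_; s≤s; z≤n)
open ≡ using (_≢_; refl; sym; trans; cong; cong₂; subst; subst₂)

∣p∣≡∣p─q∣+∣p∩q∣ : ∀ {n} (p q : Subset n) → ∣ p ∣ ≡ ∣ p ─ q ∣ + ∣ p ∩ q ∣
∣p∣≡∣p─q∣+∣p∩q∣ []            []            = refl
∣p∣≡∣p─q∣+∣p∩q∣ (outside ∷ p) (outside ∷ q) = ∣p∣≡∣p─q∣+∣p∩q∣ p q
∣p∣≡∣p─q∣+∣p∩q∣ (outside ∷ p) (inside  ∷ q) = ∣p∣≡∣p─q∣+∣p∩q∣ p q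
∣p∣≡∣p─q∣+∣p∩q∣ (inside  ∷ p) (outside ∷ q) = cong suc (∣p∣≡∣p─q∣+∣p∩q∣ p q)
∣p∣≡∣p─q∣+∣p∩q∣ (inside  ∷ p) (inside  ∷ q) =
  trans (cong suc (∣p∣≡∣p─q∣+∣p∩q∣ p q)) (sym (ℕ.+-suc ∣ p ─ q ∣ ∣ p ∩ q ∣))

-- The sets are removed one after another; each removes at most `s` points, and the remaining
-- intersections only shrink.
∣p∣≤∣p─⋃∣+r*s : ∀ {n} r s (p : Subset n) (qs : Fin r → Subset n) → (∀ k → ∣ p ∩ qs k ∣ ≤ s) →
                ∣ p ∣ ≤ ∣ p ─ ⋃ (List.tabulate qs) ∣ + r * s
∣p∣≤∣p─⋃∣+r*s zero    s p qs small = ℕ.≤-reflexive (trans (cong ∣_∣ (sym (p─⊥≡p p))) (sym (ℕ.+-identityʳ _)))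
∣p∣≤∣p─⋃∣+r*s (suc r) s p qs small = begin
  ∣ p ∣                                  ≡⟨ ∣p∣≡∣p─q∣+∣p∩q∣ p q ⟩
  ∣ p ─ q ∣ + ∣ p ∩ q ∣                  ≤⟨ ℕ.+-mono-≤ (∣p∣≤∣p─⋃∣+r*s r s (p ─ q) (qs ∘ suc) small′) (small zero) ⟩
  ∣ p ─ q ─ U ∣ + r * s + s              ≡⟨ ℕ.+-assoc ∣ p ─ q ─ U ∣ (r * s) s ⟩
  ∣ p ─ q ─ U ∣ + (r * s + s)            ≡⟨ cong₂ _+_ (cong ∣_∣ (p─q─r≡p─q∪r p q U)) (ℕ.+-comm (r * s) s) ⟩
  ∣ p ─ ⋃ (List.tabulate qs) ∣ + suc r * s  ∎
  where
  open ℕ.≤-Reasoning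
  q = qs zero
  U = ⋃ (List.tabulate (qs ∘ suc))
  small′ : ∀ k → ∣ (p ─ q) ∩ qs (suc k) ∣ ≤ s
  small′ k = ℕ.≤-trans (p⊆q⇒∣p∣≤∣q∣ λ x∈ → let x∈p─q , x∈qs = x∈p∩q⁻ (p ─ q) (qs (suc k)) x∈ in
    x∈p∩q⁺ (p─q⊆p p q x∈p─q , x∈qs)) (small (suc k))

injection⇒≤∣p∣ : ∀ {m n} (p : Subset n) (f : Fin m → Fin n) → Injective _≡_ _≡_ f → (∀ i → f i ∈ p) → m ≤ ∣ p ∣
injection⇒≤∣p∣ {zero}  p f inj f∈p = z≤n
injection⇒≤∣p∣ {suc m} p f inj f∈p = ℕ.≤-trans
  (s≤s (injection⇒≤∣p∣ (p - f zero) (f ∘ suc) (Fin.suc-injective ∘ inj)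
    λ i → x∈p∧x≢y⇒x∈p-y (f∈p (suc i)) (λ eq → Fin.0≢1+n (sym (inj eq)))))
  (x∈p⇒∣p-x∣<∣p∣ (f∈p zero))

enumerate : ∀ {n} (p : Subset n) → Fin ∣ p ∣ → Fin n
enumerate (outside ∷ p) i       = suc (enumerate p i)
enumerate (inside  ∷ p) zero    = zero
enumerate (inside  ∷ p) (suc i) = suc (enumerate p i)

enumerate-injective : ∀ {n} (p : Subset n) → Injective _≡_ _≡_ (enumerate p)
enumerate-injective (outside ∷ p)                 eq = enumerate-injective p (Fin.suc-injective eq)
enumerate-injective (inside  ∷ p) {zero}  {zero}  eq = refl
enumerate-injective (inside  ∷ p) {suc i} {suc j} eq = cong suc (enumerate-injective p (Fin.suc-injective eq))

enumerate-∈ : ∀ {n} (p : Subset n) i → enumerate p i ∈ p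
enumerate-∈ (outside ∷ p) i       = there (enumerate-∈ p i)
enumerate-∈ (inside  ∷ p) zero    = here
enumerate-∈ (inside  ∷ p) (suc i) = there (enumerate-∈ p i)

module Graph {n q : ℕ} where

  position : Fin (n * q) → Fin n
  position z = proj₁ (remQuot {n} q z)

  symbol : Fin (n * q) → Fin q
  symbol z = proj₂ (remQuot {n} q z)

  graph : (Fin n → Fin q) → Subset (n * q)
  graph w = Vec.tabulate λ z → does (w (position z) ≟ symbol z)

  ∈graph⁺ : ∀ w z → w (position z) ≡ symbol z → z ∈ graph w
  ∈graph⁺ w z eq = lookup⇒[]= z (graph w) (trans (lookup∘tabulate _ z) (dec-true (_ ≟ _) eq))

  ∈graph⁻ : ∀ w z → z ∈ graph w → w (position z) ≡ symbol z
  ∈graph⁻ w z z∈ with w (position z) ≟ symbol z | trans (sym (lookup∘tabulate (λ z → does (w (position z) ≟ symbol z)) z)) ([]=⇒lookup z∈)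
  ... | yes eq | _ = eq

  combine∈graph : ∀ w a → combine a (w a) ∈ graph w
  combine∈graph w a = ∈graph⁺ w _ (trans (cong (w ∘ proj₁) rq) (sym (cong proj₂ rq)))
    where rq = Fin.remQuot-combine {n} {q} a (w a)

  graph-injective : ∀ v w → graph v ≡ graph w → ∀ a → v a ≡ w a
  graph-injective v w eq a = sym (subst₂ (λ b y → w b ≡ y) (cong proj₁ rq) (cong proj₂ rq)
    (∈graph⁻ w _ (subst (combine a (v a) ∈_) eq (combine∈graph v a))))
    where rq = Fin.remQuot-combine {n} {q} a (v a)

  n≤∣graph∣ : ∀ w → n ≤ ∣ graph w ∣
  n≤∣graph∣ w = injection⇒≤∣p∣ (graph w) (λ a → combine a (w a))
    (λ {a} {b} eq → proj₁ (Fin.combine-injective a (w a) b (w b) eq)) (combine∈graph w)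

  -- A point of a graph is determined by its position, so `s + 1` common points would give `s + 1`
  -- distinct positions of agreement.
  ∣graph∩graph∣≤ : ∀ s v w → ((pos : Fin (suc s) → Fin n) → Injective _≡_ _≡_ pos → ¬ (∀ k → v (pos k) ≡ w (pos k))) →
                   ∣ graph v ∩ graph w ∣ ≤ s
  ∣graph∩graph∣≤ s v w apart = ℕ.≮⇒≥ λ s<∣∩∣ →
    let p     = graph v ∩ graph w
        pt    = λ k → enumerate p (inject≤ k s<∣∩∣)
        in-v  = λ k → ∈graph⁻ v (pt k) (proj₁ (x∈p∩q⁻ (graph v) (graph w) (enumerate-∈ p (inject≤ k s<∣∩∣))))
        in-w  = λ k → ∈graph⁻ w (pt k) (proj₂ (x∈p∩q⁻ (graph v) (graph w) (enumerate-∈ p (inject≤ k s<∣∩∣))))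
    in apart (position ∘ pt)
         (λ {i} {j} eq → Fin.inject≤-injective s<∣∩∣ s<∣∩∣ i j (enumerate-injective p
           (trans (sym (Fin.combine-remQuot {n} q (pt i)))
             (trans (cong₂ combine eq (trans (sym (in-v i)) (trans (cong v eq) (in-v j))))
               (Fin.combine-remQuot {n} q (pt j))))))
         (λ k → trans (in-v k) (sym (in-w k)))

-- Minimum distance at least n - m + 1, stated for indices; for `m ≤ n` it also makes the code
-- injective.
SeparatedBy : ∀ {M n q} → ℕ → (Fin M → Fin n → Fin q) → Set
SeparatedBy {M} {n} m code = ∀ {i j} (pos : Fin m → Fin n) → Injective _≡_ _≡_ pos →
                             (∀ k → code i (pos k) ≡ code j (pos k)) → i ≡ j

code⇒coverFree : ∀ {M n q s r d} (code : Fin M → Fin n → Fin q) → SeparatedBy (suc s) code → suc s ≤ n → d + r * s < n →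
                 Σ (Fin M → Subset (n * q)) λ B → Injective _≡_ _≡_ B × IsCoverFree r d B
code⇒coverFree {n = n} {q} {s} {r} {d} code sep s<n bound = B , B-injective , coverFree
  where
  open Graph {n} {q}
  B = graph ∘ code
  B-injective : Injective _≡_ _≡_ B
  B-injective {i} {j} eq = sep (λ k → inject≤ k s<n) (λ {k} {l} → Fin.inject≤-injective s<n s<n k l)
    (λ k → graph-injective (code i) (code j) eq _)
  coverFree : IsCoverFree r d B
  coverFree i js js≢i = ℕ.+-cancelʳ-< (r * s) d _ (begin-strict
    d + r * s    <⟨ bound ⟩
    n            ≤⟨ n≤∣graph∣ (code i) ⟩
    ∣ B i ∣      ≤⟨ ∣p∣≤∣p─⋃∣+r*s r s (B i) (B ∘ js) (λ k → ∣graph∩graph∣≤ s (code i) (code (js k))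
                     λ pos inj agree → js≢i k (cong B (sym (sep pos inj agree)))) ⟩
    ∣ B i ─ ⋃ (List.tabulate (B ∘ js)) ∣ + r * s  ∎)
    where open ℕ.≤-Reasoning

-- Extended Reed-Solomon codes

module ReedSolomon {q : ℕ} (F : GaloisField q) (s : ℕ) where
  open GaloisField F
  open CommutativeRing ring using (Carrier; _≈_)
  private module K = CommutativeRing ring
  open import Algebra.Properties.CommutativeSemiring.Exp K.commutativeSemiring using () renaming (_^_ to _^ₖ_)
  open import Algebra.Properties.Group K.+-group using () renaming (∙-cancelʳ to +-cancelʳ)
  open Polynomial ring

  index-injective : ∀ {x y} → index x ≡ index y → x ≈ y
  index-injective {x} {y} eq = K.trans (K.sym (elem-index x)) (K.trans (K.reflexive (cong elem eq)) (elem-index y))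

  coeff : Fin (q ^ suc s) → Fin (suc s) → Carrier
  coeff i j = elem (finToFun {q} {suc s} i j)

  coeff-injective : ∀ {i j} → (∀ k → coeff i k ≈ coeff j k) → i ≡ j
  coeff-injective {i} {j} eq = finToFun-injective {q} {suc s} i j λ k → elem-injective (eq k)

  -- The position zero is the point at infinity of the projective line.
  codeword : Fin (q ^ suc s) → Fin (suc q) → Fin q
  codeword i zero    = index (coeff i (fromℕ s))
  codeword i (suc a) = index (eval (coeff i) (elem a))

  -- `eval` peels off the constant term, whereas the point at infinity calls for splitting off the
  -- leading term.
  eval-init-last : ∀ {n} (a : Fin (suc n) → Carrier) x → eval a x ≈ eval (a ∘ inject₁) x K.+ x ^ₖ n K.* a (fromℕ n)
  eval-init-last {zero} a x = begin
    a zero K.+ x K.* K.0#          ≈⟨ K.+-cong (K.sym (K.*-identityˡ _)) (K.zeroʳ x) ⟩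
    K.1# K.* a zero K.+ K.0#       ≈⟨ K.+-comm _ _ ⟩
    K.0# K.+ K.1# K.* a zero       ∎
    where open import Relation.Binary.Reasoning.Setoid K.setoid
  eval-init-last {suc n} a x = begin
    a zero K.+ x K.* eval (a ∘ suc) x                          ≈⟨ K.+-congˡ (K.*-congˡ (eval-init-last (a ∘ suc) x)) ⟩
    a zero K.+ x K.* (E K.+ x ^ₖ n K.* L)                      ≈⟨ K.+-congˡ (K.distribˡ x E _) ⟩
    a zero K.+ (x K.* E K.+ x K.* (x ^ₖ n K.* L))              ≈⟨ K.+-congˡ (K.+-congˡ (K.*-assoc x (x ^ₖ n) L)) ⟨
    a zero K.+ (x K.* E K.+ x ^ₖ suc n K.* L)                  ≈⟨ K.+-assoc _ _ _ ⟨
    a zero K.+ x K.* E K.+ x ^ₖ suc n K.* L                    ∎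
    where
    open import Relation.Binary.Reasoning.Setoid K.setoid
    E = eval (λ i → a (suc (inject₁ i))) x
    L = a (fromℕ (suc n))

  module _ {i j : Fin (q ^ suc s)} where

    finitePoint : ∀ {x : Fin (suc q)} → x ≢ zero → codeword i x ≡ codeword j x → ∃[ y ] x ≡ suc y × eval (coeff i) (elem y) ≈ eval (coeff j) (elem y)
    finitePoint {zero}  x≢0 eq = ⊥-elim (x≢0 refl)
    finitePoint {suc y} x≢0 eq = y , refl , index-injective eq

    module _ {m : ℕ} (pos : Fin m → Fin (suc q)) (inj : Injective _≡_ _≡_ pos)
             (agree : ∀ k → codeword i (pos k) ≡ codeword j (pos k)) (≢0 : ∀ k → pos k ≢ zero) where

      points : Fin m → Carrier
      points k = elem (proj₁ (finitePoint (≢0 k) (agree k)))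

      points-injective : Injective _≡_ _≈_ points
      points-injective {k} {l} eq = inj (trans (proj₁ (proj₂ (finitePoint (≢0 k) (agree k))))
        (trans (cong suc (elem-injective eq)) (sym (proj₁ (proj₂ (finitePoint (≢0 l) (agree l)))))))

      points-agree : ∀ k → eval (coeff i) (points k) ≈ eval (coeff j) (points k)
      points-agree k = proj₂ (proj₂ (finitePoint (≢0 k) (agree k)))

  -- Without infinity, `s + 1` finite points determine the `s + 1` coefficients. With it, the
  -- leading coefficients agree, and the other `s` points determine the rest.
  separated : SeparatedBy (suc s) codeword
  separated {i} {j} pos inj agree with Fin.any? (λ k → pos k ≟ zero)
  ... | no ∄∞ = coeff-injective (eval-determines domain (coeff i) (coeff j)
      (points {i} {j} pos inj agree ≢0) (points-injective {i} {j} pos inj agree ≢0) (points-agree {i} {j} pos inj agree ≢0))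
    where
    ≢0 : ∀ k → pos k ≢ zero
    ≢0 k eq = ∄∞ (k , eq)
  ... | yes (k∞ , pos≡∞) = coeff-injective all-equal
    where
    a = coeff i
    b = coeff j
    last-equal : a (fromℕ s) ≈ b (fromℕ s)
    last-equal = index-injective (subst (λ x → codeword i x ≡ codeword j x) pos≡∞ (agree k∞))
    pos′ : Fin s → Fin (suc q)
    pos′ = pos ∘ punchIn k∞
    inj′ : Injective _≡_ _≡_ pos′
    inj′ {k} {l} eq = Fin.punchIn-injective k∞ k l (inj eq)
    agree′ : ∀ k → codeword i (pos′ k) ≡ codeword j (pos′ k)
    agree′ k = agree (punchIn k∞ k)
    ≢0 : ∀ k → pos′ k ≢ zero
    ≢0 k eq = Fin.punchInᵢ≢i k∞ k (inj (trans eq (sym pos≡∞)))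
    xs = points {i} {j} pos′ inj′ agree′ ≢0
    init-equal : ∀ k → a (inject₁ k) ≈ b (inject₁ k)
    init-equal = eval-determines domain (a ∘ inject₁) (b ∘ inject₁) xs (points-injective {i} {j} pos′ inj′ agree′ ≢0) λ k →
      -- The common leading term is cancelled from both values, leaving polynomials with `s`
      -- coefficients.
      +-cancelʳ (xs k ^ₖ s K.* b (fromℕ s)) _ _ (begin
        eval (a ∘ inject₁) (xs k) K.+ xs k ^ₖ s K.* b (fromℕ s)  ≈⟨ K.+-congˡ (K.*-congˡ last-equal) ⟨
        eval (a ∘ inject₁) (xs k) K.+ xs k ^ₖ s K.* a (fromℕ s)  ≈⟨ eval-init-last a (xs k) ⟨
        eval a (xs k)                                            ≈⟨ points-agree {i} {j} pos′ inj′ agree′ ≢0 k ⟩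
        eval b (xs k)                                            ≈⟨ eval-init-last b (xs k) ⟩
        eval (b ∘ inject₁) (xs k) K.+ xs k ^ₖ s K.* b (fromℕ s)  ∎)
      where open import Relation.Binary.Reasoning.Setoid K.setoid
    all-equal : ∀ k → a k ≈ b k
    all-equal k with view k
    ... | ‵fromℕ     = last-equal
    ... | ‵inject₁ l = init-equal l

theorem20 : (q t d : ℕ) → IsPrimePower q → (h : 2 ≤ t) → t < q → t ∸ 1 ≤ q ∸ d →
    Σ (Fin (q ^ t) → Subset (q * q + q)) λ B →
    Injective _≡_ _≡_ B × IsCoverFree (_/_ (q ∸ d) (t ∸ 1) {{nonZero-pred h}}) d B
theorem20 q t@(suc s@(suc _)) d (p , suc k , pr , _ , q≡p^k) h@(s≤s (s≤s _)) t<q s≤q∸d =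
  -- The graphs live on `suc q * q` points, which unfolds to `q + q * q`.
  subst (λ n → Σ (Fin (q ^ t) → Subset n) λ B → Injective _≡_ _≡_ B × IsCoverFree ((q ∸ d) / s) d B)
    (ℕ.+-comm q (q * q))
    (code⇒coverFree codeword separated (ℕ.m≤n⇒m≤1+n (ℕ.<⇒≤ t<q)) (s≤s (begin
      d + (q ∸ d) / s * s    ≤⟨ ℕ.+-monoʳ-≤ d (m/n*n≤m (q ∸ d) s) ⟩
      -- Here `s` is positive, so `q ∸ d` is non-zero and the subtraction is exact.
      d + (q ∸ d)            ≡⟨ ℕ.m+[n∸m]≡n (ℕ.<⇒≤ (ℕ.m∸n≢0⇒n<m {q} {d} (ℕ.m<n⇒n≢0 s≤q∸d))) ⟩
      q                      ∎)))
  where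
  open ℕ.≤-Reasoning
  open ReedSolomon (subst GaloisField (sym q≡p^k) (galoisField pr k)) s
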